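{- The positional marked patterns $1\underline{2}34$ and $1\underline{2}43$ are $pmp$-Wilf equivalent; that is, for every $n\ge1$, $\sum_{\sigma\in S_n}x^{pmp_{1\underline{2}34}(\sigma)}=\sum_{\sigma\in S_n}x^{pmp_{1\underline{2}43}(\sigma)}$.
   Context: A positional marked pattern of length $k$ is a permutation $\tau$ of $[k]$ with exactly one entry underlined; $\pi(\tau)$ is the permutation obtained by removing the underline and $u(\tau)$ is the position of the underlined entry. For a word $w$ with distinct letters, $red(w)$ replaces the $i$-th smallest letter by $i$. For $\sigma\in S_n$, $\sigma$ has a $\tau$-match at position $\ell$ if there are indices $i_1<\cdots<i_k$ with $i_{u(\tau)}=\ell$ and $red(\sigma_{i_1}\cdots\sigma_{i_k})=\pi(\tau)$; $pmp_\tau(\sigma)$ is the number of such positions. Here $1\underline{2}34$ has $\pi=1234$, $u=2$, and $1\underline{2}43$ has $\pi=1243$, $u=2$. -}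

module Defs where

open import Data.Nat using (ℕ; zero; suc; _∸_; _<?_)
import Data.Nat as ℕ
open import Data.Fin using (Fin; toℕ)
import Data.Fin as F
open import Data.List using (List; []; _∷_; map; length; filter; concatMap; allFin)
import Data.List.Properties as LP
open import Data.Vec using (Vec; toList)
import Data.Vec as V
open import Data.Maybe using (Maybe; just; nothing)
import Data.Maybe.Properties as MP
open import Data.Product using (_×_; _,_)
open import Data.List.Relation.Unary.Any using (Any; any?)
open import Data.List.Relation.Unary.Unique.Propositional using (Unique)
import Data.List.Relation.Unary.Unique.DecPropositional as UD
open import Relation.Nullary using (Dec; _×-dec_)
open import Relation.Binary.PropositionalEquality using (_≡_)

-- A positional marked pattern: the permutation π(τ) of [k] written as a list
-- of its values (one-line notation, values 1..k) and the (1-based) position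
-- u(τ) of the underlined entry.
record MarkedPattern : Set where
  constructor mp
  field
    perm : List ℕ
    mark : ℕ        -- u(τ), 1-based

open MarkedPattern public

τ₁ : MarkedPattern
τ₁ = mp (1 ∷ 2 ∷ 3 ∷ 4 ∷ []) 2

τ₂ : MarkedPattern
τ₂ = mp (1 ∷ 2 ∷ 4 ∷ 3 ∷ []) 2

-- red(w): replace the i-th smallest letter by i (for words with distinct
-- letters, the rank of x is 1 + #letters smaller than x).
count< : ℕ → List ℕ → ℕ
count< x w = length (filter (λ y → y <? x) w)

red : List ℕ → List ℕ
red w = map (λ x → suc (count< x w)) w

subseqs : {A : Set} → List A → List (List A)
subseqs [] = [] ∷ []
subseqs (x ∷ xs) = map (x ∷_) (subseqs xs) Data.List.++ subseqs xs

nth : {A : Set} → List A → ℕ → Maybe A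
nth [] _ = nothing
nth (x ∷ xs) zero = just x
nth (x ∷ xs) (suc i) = nth xs i

-- A permutation of [n] in one-line notation: a vector of n entries from
-- Fin n (entry value j ∈ Fin n stands for j+1) with no repeated entry.
IsPerm : {n : ℕ} → Vec (Fin n) n → Set
IsPerm σ = Unique (toList σ)

isPerm? : {n : ℕ} (σ : Vec (Fin n) n) → Dec (IsPerm σ)
isPerm? σ = UD.unique? F._≟_ (toList σ)

letters : {n : ℕ} → Vec (Fin n) n → List (Fin n) → List ℕ
letters σ is = map (λ i → suc (toℕ (V.lookup σ i))) is

MatchWitness : {n : ℕ} → MarkedPattern → Vec (Fin n) n → Fin n → List (Fin n) → Set
MatchWitness τ σ ℓ is =
  (length is ≡ length (perm τ)) ×
  ((nth is (mark τ ∸ 1) ≡ just ℓ) × (red (letters σ is) ≡ perm τ))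

matchWitness? : {n : ℕ} (τ : MarkedPattern) (σ : Vec (Fin n) n) (ℓ : Fin n)
  (is : List (Fin n)) → Dec (MatchWitness τ σ ℓ is)
matchWitness? τ σ ℓ is =
  (length is ℕ.≟ length (perm τ)) ×-dec
  ((MP.≡-dec F._≟_ (nth is (mark τ ∸ 1)) (just ℓ)) ×-dec
   (LP.≡-dec ℕ._≟_ (red (letters σ is)) (perm τ)))

-- σ has a τ-match at position ℓ: some increasing index sequence
-- (a subsequence of 0,1,…,n-1) witnesses it.
HasMatchAt : {n : ℕ} → MarkedPattern → Vec (Fin n) n → Fin n → Set
HasMatchAt {n} τ σ ℓ = Any (MatchWitness τ σ ℓ) (subseqs (allFin n))

hasMatchAt? : {n : ℕ} (τ : MarkedPattern) (σ : Vec (Fin n) n) (ℓ : Fin n) →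
  Dec (HasMatchAt τ σ ℓ)
hasMatchAt? {n} τ σ ℓ = any? (matchWitness? τ σ ℓ) (subseqs (allFin n))

pmp : {n : ℕ} → MarkedPattern → Vec (Fin n) n → ℕ
pmp {n} τ σ = length (filter (hasMatchAt? τ σ) (allFin n))

allVecs : (n m : ℕ) → List (Vec (Fin n) m)
allVecs n zero = V.[] ∷ []
allVecs n (suc m) = concatMap (λ i → map (i V.∷_) (allVecs n m)) (allFin n)

Sn : (n : ℕ) → List (Vec (Fin n) n)
Sn n = filter isPerm? (allVecs n n)

-- coefficient of x^k in  Σ_{σ ∈ S_n} x^{pmp_τ(σ)}
coeff : MarkedPattern → (n k : ℕ) → ℕ
coeff τ n k = length (filter (λ σ → pmp τ σ ℕ.≟ k) (Sn n))

{-# OPTIONS --safe #-}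

-- Write a permutation as x followed by a permutation of the remaining values.
-- Let t be the number of values up to the largest bottom of an ascending
-- (resp. descending) pair in a word.  A first entry of rank x (counted from 0)
-- has such a pair to its upper right iff x < t in the rest.  Prepending
-- an entry of rank x ≤ n to a word of length n sends t to t + 1 when x < t,
-- in both cases; when x runs through t, …, n the new value of t runs through
-- t + 1, …, n, t for ascents and through t, …, n for descents, so a cyclic
-- rotation of the ranks ≥ t intertwines the two.  Left-to-right minima are
-- never the marked entry; they are handled by a threshold c, the least value
-- seen to the left: a rank below c is kept and becomes the new threshold,
-- while for ranks ≥ c only max(c, t) matters, and the rotation applies with
-- max(c, t) in place of t.

module Submission where

open import Defs
open import Data.Nat
open import Data.Nat.Properties
open import Data.Fin as F using (Fin; zero; suc; toℕ; fromℕ; fromℕ<; inject₁; punchIn; punchOut)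
import Data.Fin.Properties as FP
open import Data.Fin.Properties using (toℕ≤pred[n]; toℕ<n; toℕ-fromℕ; toℕ-fromℕ<; toℕ-inject₁)
open import Data.Fin.Properties using (punchIn-injective; punchInᵢ≢i; punchIn-punchOut; punchOut-injective; punchIn-cancel-≤; punchIn-mono-≤)
open import Data.Fin.Relation.Unary.Top using (view; ‵fromℕ; ‵inject₁; view-fromℕ; view-inject₁)
open import Data.List as L using (List; []; _∷_; map; length; filter; allFin; cartesianProductWith)
open import Data.List.Properties using (filter-accept; filter-reject; map-tabulate; map-cong)
open import Data.List.Membership.Propositional using (_∈_; find; lose)
open import Data.List.Membership.Propositional.Properties using (∈-map⁺; ∈-map⁻; ∈-++⁺ˡ; ∈-++⁺ʳ; ∈-++⁻; ∈-filter⁺; ∈-filter⁻; ∈-allFin; ∈-cartesianProductWith⁺)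
open import Data.List.Membership.Propositional.Properties.WithK using (unique∧set⇒bag)
open import Data.List.Relation.Binary.BagAndSetEquality using (∼bag⇒↭)
open import Data.List.Relation.Binary.Permutation.Propositional using (_↭_)
open import Data.List.Relation.Binary.Permutation.Propositional.Properties using (filter-↭; ↭-length)
open import Data.List.Relation.Unary.All as All using (All; []; _∷_)
open import Data.List.Relation.Unary.AllPairs as AllPairs using (AllPairs; []; _∷_)
import Data.List.Relation.Unary.AllPairs.Properties as AllPairs
open import Data.List.Relation.Unary.Any using (here)
open import Data.List.Relation.Unary.Unique.Propositional using (Unique)
import Data.List.Relation.Unary.Unique.Propositional.Properties as Unique
open import Data.Vec as V using (Vec; toList)
open import Data.Vec.Membership.Propositional.Properties using (∈-lookup; ∈-toList⁺)
open import Data.Vec.Properties as VP using (lookup∘tabulate; tabulate∘lookup; tabulate-cong)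
open import Data.Product using (∃; ∃₂; _×_; _,_; proj₁; proj₂)
open import Data.Product.Function.NonDependent.Propositional using (_×-⇔_)
open import Data.Sum using (_⊎_; inj₁; inj₂)
open import Function using (_∘_; id; _⇔_; mk⇔; Equivalence)
open import Function.Construct.Composition using (_⇔-∘_)
open import Relation.Nullary using (yes; no; contradiction)
open import Relation.Unary using (Decidable)
open import Relation.Binary.PropositionalEquality

open Equivalence using (to; from)

private variable
  n : ℕ
  A B : Set

-- Inserting a rank shifts the ranks above it.

punchIn-below : ∀ (x : Fin (suc n)) v → toℕ v < toℕ x → toℕ (punchIn x v) ≡ toℕ v
punchIn-below (suc x) zero    _         = refl
punchIn-below (suc x) (suc v) (s≤s v<x) = cong suc (punchIn-below x v v<x)

punchIn-above : ∀ (x : Fin (suc n)) v → toℕ x ≤ toℕ v → toℕ (punchIn x v) ≡ suc (toℕ v)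
punchIn-above zero    v       _         = refl
punchIn-above (suc x) (suc v) (s≤s x≤v) = cong suc (punchIn-above x v x≤v)

-- Lehmer codes and the recursive statistics.

infixr 5 _∷_

-- x ∷ r stands for the permutation with first entry x whose other entries are
-- ordered as in r, i.e. a (0-based) Lehmer code.
data Code : ℕ → Set where
  []  : Code 0
  _∷_ : Fin (suc n) → Code n → Code (suc n)

-- Here n is the length of the tail. If x < t, the largest bottom t - 1 is pushed up to t. If t ≤ x
-- < n, the entry x is itself the bottom of an ascent, whence `suc x`; for descents the best new
-- bottom is the value x - 1 to its right, whence `x`.
grow₁ grow₂ : ℕ → ℕ → ℕ → ℕ
grow₁ n x t with x <? t | x <? n
... | yes _ | _     = suc t
... | no _  | yes _ = suc x
... | no _  | no _  = t
grow₂ n x t with x <? t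
... | yes _ = suc t
... | no _  = x

module Stat (grow : ℕ → ℕ → ℕ → ℕ) where

  -- One more than the largest bottom of an ascending (grow₁) or descending
  -- (grow₂) pair, and 0 if there is none; see top₁-spec and top₂-spec.
  top : Code n → ℕ
  top []              = 0
  top {suc n} (x ∷ r) = grow n (toℕ x) (top r)

  -- In matches c an entry ≥ c counts as having a smaller entry to its left.
  matches : ℕ → Code n → ℕ
  matches c []      = 0
  matches c (x ∷ r) with toℕ x <? c | toℕ x <? top r
  ... | yes _ | _     = matches (toℕ x) r
  ... | no _  | yes _ = suc (matches c r)
  ... | no _  | no _  = matches c r

open Stat grow₁ renaming (top to top₁; matches to matches₁)
open Stat grow₂ renaming (top to top₂; matches to matches₂)

top₁≤n : (r : Code n) → top₁ r ≤ n
top₁≤n [] = z≤n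
top₁≤n {suc n} (x ∷ r) with toℕ x <? top₁ r | toℕ x <? n
... | yes _ | _       = s≤s (top₁≤n r)
... | no _  | yes x<n = m≤n⇒m≤1+n x<n
... | no _  | no _    = m≤n⇒m≤1+n (top₁≤n r)

-- Cyclic rotation of ranks.

-- min(t, n); total, so that transfer carries no proof of t ≤ n.
clamp : ∀ n → ℕ → Fin (suc n)
clamp n       zero    = zero
clamp zero    (suc t) = zero
clamp (suc n) (suc t) = suc (clamp n t)

toℕ-clamp : ∀ {n t} → t ≤ n → toℕ (clamp n t) ≡ t
toℕ-clamp z≤n       = refl
toℕ-clamp (s≤s t≤n) = cong suc (toℕ-clamp t≤n)

-- The cyclic rotation t ↦ t + 1 ↦ ⋯ ↦ n ↦ t, fixing all x < t.
rotate : Fin (suc n) → Fin (suc n) → Fin (suc n)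
rotate t x with view x
... | ‵fromℕ     = t
... | ‵inject₁ i = punchIn t i

rotate-injective : ∀ (t x y : Fin (suc n)) → rotate t x ≡ rotate t y → x ≡ y
rotate-injective t x y eq with view x | view y
... | ‵fromℕ     | ‵fromℕ     = refl
... | ‵fromℕ     | ‵inject₁ j = contradiction (sym eq) (punchInᵢ≢i t j)
... | ‵inject₁ i | ‵fromℕ     = contradiction eq (punchInᵢ≢i t i)
... | ‵inject₁ i | ‵inject₁ j = cong inject₁ (punchIn-injective t i j eq)

rotate-surjective : ∀ (t y : Fin (suc n)) → ∃ λ x → rotate t x ≡ y
rotate-surjective {n} t y with t FP.≟ y
... | yes refl = fromℕ n , eq
  where
  eq : rotate t (fromℕ n) ≡ t
  eq rewrite view-fromℕ n = refl
... | no t≢y = inject₁ i , eq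
  where
  i = punchOut t≢y
  eq : rotate t (inject₁ i) ≡ y
  eq rewrite view-inject₁ i = punchIn-punchOut t≢y

rotate-below : ∀ (t x : Fin (suc n)) → toℕ x < toℕ t → toℕ (rotate t x) ≡ toℕ x
rotate-below t x x<t with view x
... | ‵fromℕ {n} = contradiction (≤-trans x<t (toℕ≤pred[n] t)) (n≮n _ ∘ subst (_< n) (toℕ-fromℕ n))
... | ‵inject₁ i = trans (punchIn-below t i (subst (_< toℕ t) (toℕ-inject₁ i) x<t)) (sym (toℕ-inject₁ i))

rotate-above : ∀ (t x : Fin (suc n)) → toℕ t ≤ toℕ x → toℕ x < n → toℕ (rotate t x) ≡ suc (toℕ x)
rotate-above {n} t x t≤x x<n with view x
... | ‵fromℕ     = contradiction (subst (_< n) (toℕ-fromℕ n) x<n) (n≮n _)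
... | ‵inject₁ i = trans (punchIn-above t i (subst (toℕ t ≤_) (toℕ-inject₁ i) t≤x)) (cong suc (sym (toℕ-inject₁ i)))

rotate-last : ∀ (t x : Fin (suc n)) → n ≤ toℕ x → rotate t x ≡ t
rotate-last {n} t x n≤x with view x
... | ‵fromℕ     = refl
... | ‵inject₁ i = contradiction (subst (n ≤_) (toℕ-inject₁ i) n≤x) (<⇒≱ (toℕ<n i))

rotate≥ : ∀ (t x : Fin (suc n)) → toℕ t ≤ toℕ x → toℕ t ≤ toℕ (rotate t x)
rotate≥ {n} t x t≤x with toℕ x <? n
... | yes x<n = subst (toℕ t ≤_) (sym (rotate-above t x t≤x x<n)) (m≤n⇒m≤1+n t≤x)
... | no x≮n  = ≤-reflexive (cong toℕ (sym (rotate-last t x (≮⇒≥ x≮n))))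

-- The transfer map on codes and its bijectivity.

-- A rotation is applied only to some x with c ≤ x ≤ n; then c ≤ n, and the clamp changes nothing.
pivot : ℕ → Code n → Fin (suc n)
pivot {n} c r = clamp n (c ⊔ top₁ r)

toℕ-pivot : ∀ {c} (r : Code n) → c ≤ n → toℕ (pivot c r) ≡ c ⊔ top₁ r
toℕ-pivot r c≤n = toℕ-clamp (⊔-lub c≤n (top₁≤n r))

c≤pivot : ∀ {c} (r : Code n) → c ≤ n → c ≤ toℕ (pivot c r)
c≤pivot {c = c} r c≤n = subst (c ≤_) (sym (toℕ-pivot r c≤n)) (m≤m⊔n c _)

transfer : ℕ → Code n → Code n
transfer c []      = []
transfer c (x ∷ r) with toℕ x <? c
... | yes _ = x ∷ transfer (toℕ x) r
... | no _  = rotate (pivot c r) x ∷ transfer c r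

transfer-below : ∀ {c} (x : Fin (suc n)) r → toℕ x < c →
                 transfer c (x ∷ r) ≡ x ∷ transfer (toℕ x) r
transfer-below {c = c} x r x<c with toℕ x <? c
... | yes _  = refl
... | no x≮c = contradiction x<c x≮c

transfer-above : ∀ {c} (x : Fin (suc n)) r → c ≤ toℕ x →
                 transfer c (x ∷ r) ≡ rotate (pivot c r) x ∷ transfer c r
transfer-above {c = c} x r c≤x with toℕ x <? c
... | yes x<c = contradiction x<c (≤⇒≯ c≤x)
... | no _    = refl

-- Ranks below t are fixed and the others are permuted among themselves, so for c ≤ t the ranks ≥ c
-- stay ≥ c and, conversely, arise only from ranks ≥ c. Hence an output of `transfer` reveals which
-- branch produced it.
c≤rotate : ∀ {c} (t x : Fin (suc n)) → c ≤ toℕ t → c ≤ toℕ x → c ≤ toℕ (rotate t x)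
c≤rotate {c = c} t x c≤t c≤x with toℕ x <? toℕ t
... | yes x<t = subst (c ≤_) (sym (rotate-below t x x<t)) c≤x
... | no x≮t  = ≤-trans c≤t (rotate≥ t x (≮⇒≥ x≮t))

rotate≥⇒≥ : ∀ {c} (t x : Fin (suc n)) → c ≤ toℕ t → c ≤ toℕ (rotate t x) → c ≤ toℕ x
rotate≥⇒≥ {c = c} t x c≤t c≤y with toℕ x <? toℕ t
... | yes x<t = subst (c ≤_) (rotate-below t x x<t) c≤y
... | no x≮t  = ≤-trans c≤t (≮⇒≥ x≮t)

∷-injective : ∀ {x y : Fin (suc n)} {r s : Code n} → x ∷ r ≡ y ∷ s → x ≡ y × r ≡ s
∷-injective refl = refl , refl

transfer-injective : ∀ c (r s : Code n) → transfer c r ≡ transfer c s → r ≡ s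
transfer-injective c [] [] _ = refl
transfer-injective c (x ∷ r) (y ∷ s) eq with toℕ x <? c | toℕ y <? c
... | yes _   | yes _   with refl , eq′ ← ∷-injective eq = cong (x ∷_) (transfer-injective (toℕ x) r s eq′)
... | yes x<c | no y≮c  with refl , _ ← ∷-injective eq =
  let c≤y = ≮⇒≥ y≮c ; c≤n = ≤-trans c≤y (toℕ≤pred[n] y) in
  contradiction (c≤rotate (pivot c s) y (c≤pivot s c≤n) c≤y) (<⇒≱ x<c)
... | no x≮c  | yes y<c with refl , _ ← ∷-injective eq =
  let c≤x = ≮⇒≥ x≮c ; c≤n = ≤-trans c≤x (toℕ≤pred[n] x) in
  contradiction (c≤rotate (pivot c r) x (c≤pivot r c≤n) c≤x) (<⇒≱ y<c)
-- The tails are identified first, because the pivot depends on the tail.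
... | no _    | no _    with eq′ , eq″ ← ∷-injective eq with refl ← transfer-injective c r s eq″ =
  cong (_∷ r) (rotate-injective (pivot c r) x y eq′)

transfer-surjective : ∀ c (s : Code n) → ∃ λ r → transfer c r ≡ s
transfer-surjective c [] = [] , refl
transfer-surjective c (y ∷ s) with toℕ y <? c
... | yes y<c with transfer-surjective (toℕ y) s
...   | r , refl = y ∷ r , transfer-below y r y<c
transfer-surjective c (y ∷ s) | no y≮c with transfer-surjective c s
...   | r , refl with rotate-surjective (pivot c r) y
...     | x , refl = x ∷ r , transfer-above x r (rotate≥⇒≥ (pivot c r) x (c≤pivot r c≤n) c≤y)
  where
  c≤y = ≮⇒≥ y≮c
  c≤n = ≤-trans c≤y (toℕ≤pred[n] y)

-- The transfer map preserves the statistics.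

-- For t ≤ x every possible value is at most x + 1 ≤ c, so c absorbs the difference between the two
-- functions. The right-hand side depends on t only through max(x, t), which is what the induction
-- controls once x is the threshold.
grow₁-below : ∀ n x t c → x < c → c ⊔ grow₁ n x t ≡ c ⊔ suc (x ⊔ t)
grow₁-below n x t c x<c with x <? t | x <? n
... | yes x<t | _     = cong (λ m → c ⊔ suc m) (sym (m≤n⇒m⊔n≡n (<⇒≤ x<t)))
... | no x≮t  | yes _ = cong (λ m → c ⊔ suc m) (sym (m≥n⇒m⊔n≡m (≮⇒≥ x≮t)))
... | no x≮t  | no _ rewrite m≥n⇒m⊔n≡m (≮⇒≥ x≮t) =
  trans (m≥n⇒m⊔n≡m (≤-trans (≮⇒≥ x≮t) (<⇒≤ x<c))) (sym (m≥n⇒m⊔n≡m x<c))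

grow₂-below : ∀ n x t c → x < c → c ⊔ grow₂ n x t ≡ c ⊔ suc (x ⊔ t)
grow₂-below n x t c x<c with x <? t
... | yes x<t = cong (λ m → c ⊔ suc m) (sym (m≤n⇒m⊔n≡n (<⇒≤ x<t)))
... | no x≮t rewrite m≥n⇒m⊔n≡m (≮⇒≥ x≮t) =
  trans (m≥n⇒m⊔n≡m (<⇒≤ x<c)) (sym (m≥n⇒m⊔n≡m x<c))

grow₁-< : ∀ n {x t} → x < t → grow₁ n x t ≡ suc t
grow₁-< n {x} {t} x<t with x <? t
... | yes _  = refl
... | no x≮t = contradiction x<t x≮t

grow₁-≥ : ∀ {n x t} → t ≤ x → x < n → grow₁ n x t ≡ suc x
grow₁-≥ {n} {x} {t} t≤x x<n with x <? t | x <? n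
... | yes x<t | _     = contradiction x<t (≤⇒≯ t≤x)
... | no _  | yes _   = refl
... | no _  | no x≮n  = contradiction x<n x≮n

grow₁-last : ∀ {n x t} → t ≤ x → n ≤ x → grow₁ n x t ≡ t
grow₁-last {n} {x} {t} t≤x n≤x with x <? t | x <? n
... | yes x<t | _     = contradiction x<t (≤⇒≯ t≤x)
... | no _  | yes x<n = contradiction x<n (≤⇒≯ n≤x)
... | no _  | no _    = refl

grow₂-< : ∀ n {x t} → x < t → grow₂ n x t ≡ suc t
grow₂-< n {x} {t} x<t with x <? t
... | yes _  = refl
... | no x≮t = contradiction x<t x≮t

grow₂-≥ : ∀ n {x t} → t ≤ x → grow₂ n x t ≡ x
grow₂-≥ n {x} {t} t≤x with x <? t
... | yes x<t = contradiction x<t (≤⇒≯ t≤x)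
... | no _    = refl

module _ (grow : ℕ → ℕ → ℕ → ℕ) where
  open Stat grow

  matches-below : ∀ {c} (x : Fin (suc n)) r → toℕ x < c → matches c (x ∷ r) ≡ matches (toℕ x) r
  matches-below {c = c} x r x<c with toℕ x <? c
  ... | yes _  = refl
  ... | no x≮c = contradiction x<c x≮c

  matches-hit : ∀ {c} (x : Fin (suc n)) r → c ≤ toℕ x → toℕ x < top r →
                matches c (x ∷ r) ≡ suc (matches c r)
  matches-hit {c = c} x r c≤x x<t with toℕ x <? c | toℕ x <? top r
  ... | yes x<c | _      = contradiction x<c (≤⇒≯ c≤x)
  ... | no _    | yes _  = refl
  ... | no _    | no x≮t = contradiction x<t x≮t

  matches-miss : ∀ {c} (x : Fin (suc n)) r → c ≤ toℕ x → top r ≤ toℕ x →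
                 matches c (x ∷ r) ≡ matches c r
  matches-miss {c = c} x r c≤x t≤x with toℕ x <? c | toℕ x <? top r
  ... | yes x<c | _       = contradiction x<c (≤⇒≯ c≤x)
  ... | no _    | yes x<t = contradiction x<t (≤⇒≯ t≤x)
  ... | no _    | no _    = refl

<⊔⇒⊔≡ : ∀ {x c t} → c ≤ x → x < c ⊔ t → c ⊔ t ≡ t
<⊔⇒⊔≡ {x} {c} {t} c≤x x<c⊔t with ≤-total c t
... | inj₁ c≤t = m≤n⇒m⊔n≡n c≤t
... | inj₂ t≤c = contradiction (<-≤-trans x<c⊔t (≤-reflexive (m≥n⇒m⊔n≡m t≤c))) (≤⇒≯ c≤x)

-- Below the pivot x is fixed and is a match on both sides. From the pivot on, x and its image are
-- at or above the `top` of their respective tails, so neither is a match.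
rotate-stats : ∀ {c} (x : Fin (suc n)) (r s : Code n) → c ≤ toℕ x →
               matches₁ c r ≡ matches₂ c s → c ⊔ top₁ r ≡ c ⊔ top₂ s →
               let y = rotate (pivot c r) x in
               matches₁ c (x ∷ r) ≡ matches₂ c (y ∷ s) ×
               c ⊔ top₁ (x ∷ r) ≡ c ⊔ top₂ (y ∷ s)
rotate-stats {n} {c} x r s c≤x meq teq = proof
  where
  p   = pivot c r
  y   = rotate p x
  c≤n = ≤-trans c≤x (toℕ≤pred[n] x)
  p≡  = toℕ-pivot r c≤n
  c≤y = c≤rotate p x (c≤pivot r c≤n) c≤x
  top₁≤p : top₁ r ≤ toℕ p
  top₁≤p = subst (top₁ r ≤_) (sym p≡) (m≤n⊔m c _)
  top₂≤p : top₂ s ≤ toℕ p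
  top₂≤p = subst (top₂ s ≤_) (sym (trans p≡ teq)) (m≤n⊔m c _)
  Goal = matches₁ c (x ∷ r) ≡ matches₂ c (y ∷ s) ×
         c ⊔ top₁ (x ∷ r) ≡ c ⊔ top₂ (y ∷ s)

  hit : toℕ x < toℕ p → Goal
  hit x<p =
    trans (matches-hit grow₁ x r c≤x x<t₁)
      (trans (cong suc meq) (sym (matches-hit grow₂ y s c≤y y<t₂))) ,
    cong (c ⊔_) (trans (grow₁-< n x<t₁) (trans (cong suc t₁≡t₂) (sym (grow₂-< n y<t₂))))
    where
    x<c⊔t₁ = subst (toℕ x <_) p≡ x<p
    x<c⊔t₂ = subst (toℕ x <_) teq x<c⊔t₁
    -- Since c ≤ x < max(c, t), the maximum is t itself on each side, and the equality of maxima
    -- becomes one of tops.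
    t₁≡ = <⊔⇒⊔≡ c≤x x<c⊔t₁
    t₂≡ = <⊔⇒⊔≡ c≤x x<c⊔t₂
    t₁≡t₂ = trans (sym t₁≡) (trans teq t₂≡)
    x<t₁ = subst (toℕ x <_) t₁≡ x<c⊔t₁
    y<t₂ = subst₂ _<_ (sym (rotate-below p x x<p)) t₂≡ x<c⊔t₂

  -- Here `grow₂` returns the rotated rank y itself, so it remains to compare y with the new `top₁`.
  miss : toℕ p ≤ toℕ x → c ⊔ top₁ (x ∷ r) ≡ c ⊔ toℕ y → Goal
  miss p≤x top≡ =
    trans (matches-miss grow₁ x r c≤x (≤-trans top₁≤p p≤x))
      (trans meq (sym (matches-miss grow₂ y s c≤y t₂≤y))) ,
    trans top≡ (cong (c ⊔_) (sym (grow₂-≥ n t₂≤y)))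
    where
    t₂≤y = ≤-trans top₂≤p (rotate≥ p x p≤x)

  proof : Goal
  proof with <-≤-connex (toℕ x) (toℕ p) | <-≤-connex (toℕ x) n
  ... | inj₁ x<p | _        = hit x<p
  ... | inj₂ p≤x | inj₁ x<n = miss p≤x
    (cong (c ⊔_) (trans (grow₁-≥ (≤-trans top₁≤p p≤x) x<n) (sym (rotate-above p x p≤x x<n))))
  -- The largest rank starts no ascent, so `top₁` is unchanged; the rotation sends this rank to the
  -- pivot, which is max(c, `top₁ r`).
  ... | inj₂ p≤x | inj₂ n≤x = miss p≤x (begin
    c ⊔ top₁ (x ∷ r)   ≡⟨ cong (c ⊔_) (grow₁-last (≤-trans top₁≤p p≤x) n≤x) ⟩
    c ⊔ top₁ r         ≡⟨ p≡ ⟨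
    toℕ p              ≡⟨ m≤n⇒m⊔n≡n (c≤pivot r c≤n) ⟨
    c ⊔ toℕ p          ≡⟨ cong (λ z → c ⊔ toℕ z) (rotate-last p x n≤x) ⟨
    c ⊔ toℕ y          ∎)
    where open ≡-Reasoning

-- The count needs the second equality for its induction, since each new entry is compared with
-- `top`. The tops themselves may differ below c, so only their maxima with c are compared.
transfer-stats : ∀ c (r : Code n) → matches₁ c r ≡ matches₂ c (transfer c r) ×
                 c ⊔ top₁ r ≡ c ⊔ top₂ (transfer c r)
transfer-stats c [] = refl , refl
transfer-stats {suc n} c (x ∷ r) with <-≤-connex (toℕ x) c
... | inj₂ c≤x rewrite transfer-above x r c≤x =
  let ihm , iht = transfer-stats c r in rotate-stats x r (transfer c r) c≤x ihm iht
... | inj₁ x<c rewrite transfer-below x r x<c =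
  let ihm , iht = transfer-stats (toℕ x) r in
  trans (matches-below grow₁ x r x<c) (trans ihm (sym (matches-below grow₂ x s x<c))) ,
  (begin
    c ⊔ grow₁ n (toℕ x) (top₁ r)  ≡⟨ grow₁-below n (toℕ x) (top₁ r) c x<c ⟩
    c ⊔ suc (toℕ x ⊔ top₁ r)      ≡⟨ cong (λ m → c ⊔ suc m) iht ⟩
    c ⊔ suc (toℕ x ⊔ top₂ s)      ≡⟨ grow₂-below n (toℕ x) (top₂ s) c x<c ⟨
    c ⊔ grow₂ n (toℕ x) (top₂ s)  ∎)
  where
  open ≡-Reasoning
  s = transfer (toℕ x) r

-- Ascending and descending pairs in the coded permutation.

≤-punchIn-below : ∀ {y} (x : Fin (suc n)) v → y ≤ toℕ x → y ≤ toℕ (punchIn x v) ⇔ y ≤ toℕ v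
≤-punchIn-below {y = y} x v y≤x with <-≤-connex (toℕ v) (toℕ x)
... | inj₁ v<x rewrite punchIn-below x v v<x = mk⇔ (λ p → p) (λ p → p)
... | inj₂ x≤v rewrite punchIn-above x v x≤v = mk⇔ (λ _ → ≤-trans y≤x x≤v) m≤n⇒m≤1+n

≤-punchIn-above : ∀ {y} (x : Fin (suc n)) v → toℕ x ≤ y → suc y ≤ toℕ (punchIn x v) ⇔ y ≤ toℕ v
≤-punchIn-above {y = y} x v x≤y with <-≤-connex (toℕ v) (toℕ x)
... | inj₁ v<x rewrite punchIn-below x v v<x =
  mk⇔ <⇒≤ (λ y≤v → contradiction (<-≤-trans v<x x≤y) (≤⇒≯ y≤v))
... | inj₂ x≤v rewrite punchIn-above x v x≤v = mk⇔ s≤s⁻¹ s≤s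

<-punchIn : ∀ (x : Fin (suc n)) v w → toℕ (punchIn x v) < toℕ (punchIn x w) ⇔ toℕ v < toℕ w
<-punchIn x v w = mk⇔
  (λ lt → ≰⇒> (<⇒≱ lt ∘ punchIn-mono-≤ x w v))
  (λ lt → ≰⇒> (<⇒≱ lt ∘ punchIn-cancel-≤ x w v))

entry : Code n → Fin n → Fin n
entry (x ∷ r) zero    = x
entry (x ∷ r) (suc i) = punchIn x (entry r i)

val : Code n → Fin n → ℕ
val r i = toℕ (entry r i)

entry-surjective : ∀ (r : Code n) v → ∃ λ i → entry r i ≡ v
entry-surjective (x ∷ r) v with x FP.≟ v
... | yes x≡v = zero , x≡v
... | no x≢v  =
  let i , eq = entry-surjective r (punchOut x≢v) in
  suc i , trans (cong (punchIn x) eq) (punchIn-punchOut x≢v)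

val-surjective : ∀ (r : Code n) {v} → v < n → ∃ λ i → val r i ≡ v
val-surjective r v<n =
  let i , eq = entry-surjective r (fromℕ< v<n) in
  i , trans (cong toℕ eq) (toℕ-fromℕ< v<n)

-- The bound y on the bottom has two uses: letting y vary measures the largest bottom, and taking y
-- one above a marked value puts both later letters above that value.
Ascent Descent : ℕ → ℕ → ℕ → Set
Ascent  y v w = y ≤ v × v < w
Descent y v w = Ascent y w v

-- Inserting x preserves the order of the later entries and shifts bounds above x. At y = x both
-- fields apply: no later entry has the value x, so the bounds x and x + 1 say the same.
record Liftable (R : ℕ → ℕ → ℕ → Set) : Set where
  field
    lift-below : ∀ {n y} (x : Fin (suc n)) v w → y ≤ toℕ x →
                 R y (toℕ (punchIn x v)) (toℕ (punchIn x w)) ⇔ R y (toℕ v) (toℕ w)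
    lift-above : ∀ {n y} (x : Fin (suc n)) v w → toℕ x ≤ y →
                 R (suc y) (toℕ (punchIn x v)) (toℕ (punchIn x w)) ⇔ R y (toℕ v) (toℕ w)

  lift-entry : ∀ {n} (x : Fin (suc n)) u v w →
               R (suc (toℕ (punchIn x u))) (toℕ (punchIn x v)) (toℕ (punchIn x w)) ⇔
               R (suc (toℕ u)) (toℕ v) (toℕ w)
  lift-entry x u v w with <-≤-connex (toℕ u) (toℕ x)
  ... | inj₁ u<x rewrite punchIn-below x u u<x = lift-below x v w u<x
  ... | inj₂ x≤u rewrite punchIn-above x u x≤u = lift-above x v w (m≤n⇒m≤1+n x≤u)

open Liftable

ascent-liftable : Liftable Ascent
ascent-liftable .lift-below x v w y≤x = ≤-punchIn-below x v y≤x ×-⇔ <-punchIn x v w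
ascent-liftable .lift-above x v w x≤y = ≤-punchIn-above x v x≤y ×-⇔ <-punchIn x v w

descent-liftable : Liftable Descent
descent-liftable .lift-below x v w = lift-below ascent-liftable x w v
descent-liftable .lift-above x v w = lift-above ascent-liftable x w v

Pair : (ℕ → ℕ → ℕ → Set) → ℕ → Code n → Set
Pair R y r = ∃₂ λ i j → i F.< j × R y (val r i) (val r j)

module _ {R : ℕ → ℕ → ℕ → Set} (L : Liftable R) {t : ℕ} {x : Fin (suc n)} {r : Code n}
         (spec : ∀ y → y < t ⇔ Pair R y r) where

  pair-below : ∀ {y} → y ≤ toℕ x → y < t → Pair R y (x ∷ r)
  pair-below y≤x y<t =
    let i , j , i<j , p = to (spec _) y<t in
    suc i , suc j , s≤s i<j , from (lift-below L x _ _ y≤x) p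

  pair-above : ∀ {y} → toℕ x < t → y < suc t → Pair R y (x ∷ r)
  pair-above {y} x<t y<1+t with <-≤-connex (toℕ x) y
  ... | inj₂ y≤x = pair-below y≤x (≤-<-trans y≤x x<t)
  ... | inj₁ (s≤s x≤y) =
    let i , j , i<j , p = to (spec _) (s≤s⁻¹ y<1+t) in
    suc i , suc j , s≤s i<j , from (lift-above L x _ _ x≤y) p

  -- A bound y ≤ x is unchanged in the tail. A bound above x drops by one there, which yields x < t;
  -- only then is the exact value t + 1 needed. Both growth functions satisfy these two conditions
  -- on `t′`.
  pair-tail : ∀ {y t′} → t ≤ t′ → (toℕ x < t → t′ ≡ suc t) → ∀ i j → i F.< j →
              R y (val (x ∷ r) (suc i)) (val (x ∷ r) (suc j)) → y < t′
  pair-tail {y} t≤t′ grows i j i<j p with <-≤-connex (toℕ x) y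
  ... | inj₂ y≤x = <-≤-trans (from (spec _) (i , j , i<j , to (lift-below L x _ _ y≤x) p)) t≤t′
  ... | inj₁ (s≤s x≤y) =
    let y<t = from (spec _) (i , j , i<j , to (lift-above L x _ _ x≤y) p) in
    subst (y <_) (sym (grows (≤-<-trans x≤y y<t))) (s≤s y<t)

t≤grow₁ : ∀ n x t → t ≤ grow₁ n x t
t≤grow₁ n x t with x <? t | x <? n
... | yes _  | _     = n≤1+n t
... | no x≮t | yes _ = m≤n⇒m≤1+n (≮⇒≥ x≮t)
... | no _   | no _  = ≤-refl

t≤grow₂ : ∀ n x t → t ≤ grow₂ n x t
t≤grow₂ n x t with x <? t
... | yes _  = n≤1+n t
... | no x≮t = ≮⇒≥ x≮t

x<grow₁ : ∀ n x t → x < n → x < grow₁ n x t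
x<grow₁ n x t x<n with x <? t | x <? n
... | yes x<t | _      = m≤n⇒m≤1+n x<t
... | no _    | yes _  = ≤-refl
... | no _    | no x≮n = contradiction x<n x≮n

x≤grow₂ : ∀ n x t → x ≤ grow₂ n x t
x≤grow₂ n x t with x <? t
... | yes x<t = m≤n⇒m≤1+n (<⇒≤ x<t)
... | no _    = ≤-refl

top₁-spec : ∀ (r : Code n) y → y < top₁ r ⇔ Pair Ascent y r
top₁-spec [] y = mk⇔ (λ ()) (λ ())
top₁-spec {suc n} (x ∷ r) y = mk⇔ ⇒ ⇐
  where
  t = top₁ r

  ⇒ : y < top₁ (x ∷ r) → Pair Ascent y (x ∷ r)
  ⇒ y<t′ with <-≤-connex (toℕ x) t | <-≤-connex (toℕ x) n
  ... | inj₁ x<t | _ =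
    pair-above ascent-liftable (top₁-spec r) x<t (subst (y <_) (grow₁-< n x<t) y<t′)
  ... | inj₂ t≤x | inj₁ x<n =
    -- The entry of rank x in the tail becomes x + 1, the top of an ascent starting at x.
    let j , eq = val-surjective r x<n in
    zero , suc j , s≤s z≤n , s≤s⁻¹ (subst (y <_) (grow₁-≥ t≤x x<n) y<t′) ,
    from (≤-punchIn-above x (entry r j) ≤-refl) (≤-reflexive (sym eq))
  ... | inj₂ t≤x | inj₂ n≤x =
    let y<t = subst (y <_) (grow₁-last t≤x n≤x) y<t′ in
    pair-below ascent-liftable (top₁-spec r) (≤-trans (<⇒≤ y<t) t≤x) y<t

  ⇐ : Pair Ascent y (x ∷ r) → y < top₁ (x ∷ r)
  ⇐ (zero , suc j , _ , y≤x , x<v) = ≤-<-trans y≤x (x<grow₁ n (toℕ x) t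
    (≤-<-trans (to (≤-punchIn-above x (entry r j) ≤-refl) x<v) (toℕ<n (entry r j))))
  ⇐ (suc i , suc j , s≤s i<j , p) =
    pair-tail ascent-liftable {r = r} (top₁-spec r) (t≤grow₁ n (toℕ x) t) (grow₁-< n) i j i<j p

top₂-spec : ∀ (r : Code n) y → y < top₂ r ⇔ Pair Descent y r
top₂-spec [] y = mk⇔ (λ ()) (λ ())
top₂-spec {suc n} (x ∷ r) y = mk⇔ ⇒ ⇐
  where
  t = top₂ r

  ⇒ : y < top₂ (x ∷ r) → Pair Descent y (x ∷ r)
  ⇒ y<t′ with <-≤-connex (toℕ x) t
  ... | inj₁ x<t =
    pair-above descent-liftable (top₂-spec r) x<t (subst (y <_) (grow₂-< n x<t) y<t′)
  ... | inj₂ t≤x =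
    -- The bottom is chosen to be y: as y < x, the tail entry of rank y keeps its value.
    let y<x    = subst (y <_) (grow₂-≥ n t≤x) y<t′
        j , eq = val-surjective r (<-≤-trans y<x (toℕ≤pred[n] x))
        eq′    = trans (punchIn-below x (entry r j) (subst (_< toℕ x) (sym eq) y<x)) eq in
    zero , suc j , s≤s z≤n , ≤-reflexive (sym eq′) , subst (_< toℕ x) (sym eq′) y<x

  ⇐ : Pair Descent y (x ∷ r) → y < top₂ (x ∷ r)
  ⇐ (zero , suc j , _ , y≤v , v<x) = <-≤-trans (≤-<-trans y≤v v<x) (x≤grow₂ n (toℕ x) t)
  ⇐ (suc i , suc j , s≤s i<j , p) =
    pair-tail descent-liftable {r = r} (top₂-spec r) (t≤grow₂ n (toℕ x) t) (grow₂-< n) i j i<j p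

-- Matches and their recursive count.

-- For c = n the first alternative is void, and this is a match at position ℓ.
Match : (ℕ → ℕ → ℕ → Set) → ℕ → Code n → Fin n → Set
Match R c r ℓ =
  (c ≤ val r ℓ ⊎ ∃ λ a → a F.< ℓ × val r a < val r ℓ) ×
  ∃₂ λ i j → ℓ F.< i × i F.< j × R (suc (val r ℓ)) (val r i) (val r j)

module _ {R : ℕ → ℕ → ℕ → Set} (L : Liftable R) where

  -- Nothing stands to the left of the first entry, so only the threshold can provide the smaller
  -- letter. The bound x + 1 on later entries is the bound x in the ranks of the tail, to which
  -- `spec` applies.
  match-zero : ∀ {c t} (x : Fin (suc n)) (r : Code n) → (∀ y → y < t ⇔ Pair R y r) →
               Match R c (x ∷ r) zero ⇔ (c ≤ toℕ x × toℕ x < t)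
  match-zero {c = c} {t} x r spec = mk⇔ ⇒ ⇐
    where
    ⇒ : Match R c (x ∷ r) zero → c ≤ toℕ x × toℕ x < t
    ⇒ (inj₁ c≤x , suc i , suc j , _ , s≤s i<j , p) =
      c≤x , from (spec _) (i , j , i<j , to (lift-above L x _ _ ≤-refl) p)
    ⇐ : c ≤ toℕ x × toℕ x < t → Match R c (x ∷ r) zero
    ⇐ (c≤x , x<t) =
      let i , j , i<j , p = to (spec _) x<t in
      inj₁ c≤x , suc i , suc j , s≤s z≤n , s≤s i<j , from (lift-above L x _ _ ≤-refl) p

  -- The hypothesis `low` merges the threshold c and the new entry x into one threshold d for the
  -- tail.
  match-suc : ∀ {c d} (x : Fin (suc n)) (r : Code n) ℓ →
              (c ≤ val (x ∷ r) (suc ℓ) ⊎ toℕ x < val (x ∷ r) (suc ℓ)) ⇔ d ≤ val r ℓ →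
              Match R c (x ∷ r) (suc ℓ) ⇔ Match R d r ℓ
  match-suc {c = c} {d} x r ℓ low = mk⇔ ⇒ ⇐
    where
    low⇒ : (c ≤ val (x ∷ r) (suc ℓ) ⊎ ∃ λ a → a F.< suc ℓ × val (x ∷ r) a < val (x ∷ r) (suc ℓ)) →
           d ≤ val r ℓ ⊎ ∃ λ a → a F.< ℓ × val r a < val r ℓ
    low⇒ (inj₁ c≤v)                     = inj₁ (to low (inj₁ c≤v))
    low⇒ (inj₂ (zero , _ , x<v))        = inj₁ (to low (inj₂ x<v))
    low⇒ (inj₂ (suc a , s≤s a<ℓ , u<v)) = inj₂ (a , a<ℓ , to (<-punchIn x _ _) u<v)

    low⇐ : d ≤ val r ℓ ⊎ (∃ λ a → a F.< ℓ × val r a < val r ℓ) →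
           c ≤ val (x ∷ r) (suc ℓ) ⊎ ∃ λ a → a F.< suc ℓ × val (x ∷ r) a < val (x ∷ r) (suc ℓ)
    low⇐ (inj₂ (a , a<ℓ , u<v)) = inj₂ (suc a , s≤s a<ℓ , from (<-punchIn x _ _) u<v)
    low⇐ (inj₁ d≤v) with from low d≤v
    ... | inj₁ c≤v = inj₁ c≤v
    ... | inj₂ x<v = inj₂ (zero , s≤s z≤n , x<v)

    ⇒ : Match R c (x ∷ r) (suc ℓ) → Match R d r ℓ
    ⇒ (l , suc i , suc j , s≤s ℓ<i , s≤s i<j , p) =
      low⇒ l , i , j , ℓ<i , i<j , to (lift-entry L x _ _ _) p
    ⇐ : Match R d r ℓ → Match R c (x ∷ r) (suc ℓ)
    ⇐ (l , i , j , ℓ<i , i<j , p) =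
      low⇐ l , suc i , suc j , s≤s ℓ<i , s≤s i<j , from (lift-entry L x _ _ _) p

  -- Reaching c implies exceeding x, and the entries exceeding x are those of rank ≥ x in the tail;
  -- so x is the new threshold.
  match-suc-below : ∀ {c} (x : Fin (suc n)) (r : Code n) ℓ → toℕ x < c →
                    Match R c (x ∷ r) (suc ℓ) ⇔ Match R (toℕ x) r ℓ
  match-suc-below x r ℓ x<c = match-suc x r ℓ (mk⇔
    (λ { (inj₁ c≤v) → to above (<-≤-trans x<c c≤v) ; (inj₂ x<v) → to above x<v })
    (inj₂ ∘ from above))
    where above = ≤-punchIn-above x (entry r ℓ) ≤-refl

  -- An entry exceeding x already reaches c, and inserting x does not affect comparison with c.
  match-suc-above : ∀ {c} (x : Fin (suc n)) (r : Code n) ℓ → c ≤ toℕ x →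
                    Match R c (x ∷ r) (suc ℓ) ⇔ Match R c r ℓ
  match-suc-above x r ℓ c≤x = match-suc x r ℓ (mk⇔
    (λ { (inj₁ c≤v) → to below c≤v ; (inj₂ x<v) → to below (≤-trans c≤x (<⇒≤ x<v)) })
    (inj₁ ∘ from below))
    where below = ≤-punchIn-below x (entry r ℓ) c≤x

  module _ (grow : ℕ → ℕ → ℕ → ℕ)
           (spec : ∀ {n} (r : Code n) y → y < Stat.top grow r ⇔ Pair R y r)
           {A : Set} {P : A → Set} (P? : Decidable P) where
    open Stat grow

    -- The general `f` serves the recursion, which composes it with `suc` to address positions of
    -- the tail.
    length-filter≡matches : ∀ c (r : Code n) (f : Fin n → A) →
      (∀ ℓ → P (f ℓ) ⇔ Match R c r ℓ) → length (filter P? (L.tabulate f)) ≡ matches c r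
    length-filter≡matches c [] f P⇔ = refl
    length-filter≡matches c (x ∷ r) f P⇔
      with <-≤-connex (toℕ x) c | <-≤-connex (toℕ x) (top r) | match-zero {c = c} x r (spec r)
    ... | inj₁ x<c | _ | zero⇔ = begin
      length (filter P? (f zero ∷ L.tabulate (f ∘ suc)))
        ≡⟨ cong length (filter-reject P? (λ p → <⇒≱ x<c (proj₁ (to zero⇔ (to (P⇔ zero) p))))) ⟩
      length (filter P? (L.tabulate (f ∘ suc)))
        ≡⟨ length-filter≡matches (toℕ x) r (f ∘ suc) (λ ℓ → match-suc-below x r ℓ x<c ⇔-∘ P⇔ (suc ℓ)) ⟩
      matches (toℕ x) r
        ≡⟨ matches-below grow x r x<c ⟨
      matches c (x ∷ r) ∎
      where open ≡-Reasoning
    ... | inj₂ c≤x | inj₁ x<t | zero⇔ = begin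
      length (filter P? (f zero ∷ L.tabulate (f ∘ suc)))
        ≡⟨ cong length (filter-accept P? (from (P⇔ zero) (from zero⇔ (c≤x , x<t)))) ⟩
      suc (length (filter P? (L.tabulate (f ∘ suc))))
        ≡⟨ cong suc (length-filter≡matches c r (f ∘ suc) (λ ℓ → match-suc-above x r ℓ c≤x ⇔-∘ P⇔ (suc ℓ))) ⟩
      suc (matches c r)
        ≡⟨ matches-hit grow x r c≤x x<t ⟨
      matches c (x ∷ r) ∎
      where open ≡-Reasoning
    ... | inj₂ c≤x | inj₂ t≤x | zero⇔ = begin
      length (filter P? (f zero ∷ L.tabulate (f ∘ suc)))
        ≡⟨ cong length (filter-reject P? (λ p → ≤⇒≯ t≤x (proj₂ (to zero⇔ (to (P⇔ zero) p))))) ⟩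
      length (filter P? (L.tabulate (f ∘ suc)))
        ≡⟨ length-filter≡matches c r (f ∘ suc) (λ ℓ → match-suc-above x r ℓ c≤x ⇔-∘ P⇔ (suc ℓ)) ⟩
      matches c r
        ≡⟨ matches-miss grow x r c≤x t≤x ⟨
      matches c (x ∷ r) ∎
      where open ≡-Reasoning

-- Subsequences of positions are the increasing sequences.

subseqs-All : ∀ {P : A → Set} {xs} → All P xs → ∀ {ys} → ys ∈ subseqs xs → All P ys
subseqs-All []         (here refl) = []
subseqs-All {xs = x ∷ xs} (px ∷ pxs) ys∈ with ∈-++⁻ (map (x ∷_) (subseqs xs)) ys∈
... | inj₂ ys∈′ = subseqs-All pxs ys∈′
... | inj₁ ys∈′ with _ , zs∈ , refl ← ∈-map⁻ (x ∷_) ys∈′ = px ∷ subseqs-All pxs zs∈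

subseqs-AllPairs : ∀ {R : A → A → Set} {xs} → AllPairs R xs → ∀ {ys} → ys ∈ subseqs xs → AllPairs R ys
subseqs-AllPairs []         (here refl) = []
subseqs-AllPairs {xs = x ∷ xs} (px ∷ pxs) ys∈ with ∈-++⁻ (map (x ∷_) (subseqs xs)) ys∈
... | inj₂ ys∈′ = subseqs-AllPairs pxs ys∈′
... | inj₁ ys∈′ with _ , zs∈ , refl ← ∈-map⁻ (x ∷_) ys∈′ = subseqs-All px zs∈ ∷ subseqs-AllPairs pxs zs∈

[]∈subseqs : (xs : List A) → [] ∈ subseqs xs
[]∈subseqs []       = here refl
[]∈subseqs (x ∷ xs) = ∈-++⁺ʳ (map (x ∷_) (subseqs xs)) ([]∈subseqs xs)

map∈subseqs : ∀ (f : A → B) xs {ys} → ys ∈ subseqs xs → map f ys ∈ subseqs (map f xs)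
map∈subseqs f [] (here refl) = here refl
map∈subseqs f (x ∷ xs) ys∈ with ∈-++⁻ (map (x ∷_) (subseqs xs)) ys∈
... | inj₂ ys∈′ = ∈-++⁺ʳ (map (f x ∷_) (subseqs (map f xs))) (map∈subseqs f xs ys∈′)
... | inj₁ ys∈′ with _ , zs∈ , refl ← ∈-map⁻ (x ∷_) ys∈′ =
  ∈-++⁺ˡ (∈-map⁺ (f x ∷_) (map∈subseqs f xs zs∈))

positive⇒map-suc : ∀ {is : List (Fin (suc n))} → All (zero {n} F.<_) is → ∃ λ js → is ≡ map suc js
positive⇒map-suc [] = [] , refl
positive⇒map-suc {is = suc i ∷ _} (_ ∷ pos) =
  let js , eq = positive⇒map-suc pos in i ∷ js , cong (suc i ∷_) eq

-- After a possible initial `zero` all members are positive, hence successors of an increasing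
-- sequence over a smaller range.
increasing∈subseqs : ∀ {is : List (Fin n)} → AllPairs F._<_ is → is ∈ subseqs (allFin n)
increasing∈subseqs {zero} {[]} _ = here refl
increasing∈subseqs {suc n} inc = subst (λ ys → _ ∈ subseqs (zero ∷ ys)) (map-tabulate id suc) (helper inc)
  where
  zs = map suc (allFin n)

  shifted : ∀ {is} → All (zero {n} F.<_) is → AllPairs F._<_ is → is ∈ subseqs zs
  shifted pos inc with js , refl ← positive⇒map-suc pos =
    map∈subseqs suc (allFin n) (increasing∈subseqs (AllPairs.map s≤s⁻¹ (AllPairs.map⁻ inc)))

  helper : ∀ {is} → AllPairs F._<_ is → is ∈ subseqs (zero ∷ zs)
  helper []                     = []∈subseqs (zero ∷ zs)
  helper {zero ∷ is}  (pos ∷ inc) = ∈-++⁺ˡ (∈-map⁺ (zero ∷_) (shifted pos inc))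
  helper {suc i ∷ is} (i< ∷ inc) = ∈-++⁺ʳ (map (zero ∷_) (subseqs zs))
    (shifted (s≤s z≤n ∷ All.map (<-trans (s≤s z≤n)) i<) (i< ∷ inc))

-- Reduction of words with four letters.

count<-hit : ∀ {x y} w → y < x → count< x (y ∷ w) ≡ suc (count< x w)
count<-hit {x} w y<x = cong length (filter-accept (_<? x) y<x)

count<-miss : ∀ {x y} w → x ≤ y → count< x (y ∷ w) ≡ count< x w
count<-miss {x} w x≤y = cong length (filter-reject (_<? x) (≤⇒≯ x≤y))

count<-mono : ∀ {x y} w → x ≤ y → count< x w ≤ count< y w
count<-mono [] x≤y = z≤n
count<-mono {x} {y} (z ∷ w) x≤y with <-≤-connex z x | <-≤-connex z y
... | inj₁ z<x | _ rewrite count<-hit w z<x | count<-hit w (<-≤-trans z<x x≤y) = s≤s (count<-mono w x≤y)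
... | inj₂ x≤z | inj₁ z<y rewrite count<-miss w x≤z | count<-hit w z<y = m≤n⇒m≤1+n (count<-mono w x≤y)
... | inj₂ x≤z | inj₂ y≤z rewrite count<-miss w x≤z | count<-miss w y≤z = count<-mono w x≤y

-- The graph of count<, whose indices stay readable where count< unfolds.
data Rank (x : ℕ) : List ℕ → ℕ → Set where
  none : Rank x [] 0
  hit  : ∀ {y w k} → y < x → Rank x w k → Rank x (y ∷ w) (suc k)
  miss : ∀ {y w k} → x ≤ y → Rank x w k → Rank x (y ∷ w) k

Rank⇒count< : ∀ {x w k} → Rank x w k → count< x w ≡ k
Rank⇒count< none = refl
Rank⇒count< (hit {w = w} y<x rank)  = trans (count<-hit w y<x) (cong suc (Rank⇒count< rank))
Rank⇒count< (miss {w = w} x≤y rank) = trans (count<-miss w x≤y) (Rank⇒count< rank)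

-- An abstract `f` and variable results let the list equation split by matching on `refl`.
module _ (f : ℕ → ℕ) (a b c d : ℕ) {i j k l : ℕ} where

  map⁴⁺ : f a ≡ i → f b ≡ j → f c ≡ k → f d ≡ l → map f (a ∷ b ∷ c ∷ d ∷ []) ≡ i ∷ j ∷ k ∷ l ∷ []
  map⁴⁺ refl refl refl refl = refl

  map⁴⁻ : map f (a ∷ b ∷ c ∷ d ∷ []) ≡ i ∷ j ∷ k ∷ l ∷ [] → f a ≡ i × f b ≡ j × f c ≡ k × f d ≡ l
  map⁴⁻ refl = refl , refl , refl , refl

rank : List ℕ → ℕ → ℕ
rank w x = suc (count< x w)

-- Ranks are monotone in the letter, so a strict inequality of ranks can only come from one of
-- letters.
rank-cancel : ∀ w x y {i j} → rank w x ≡ i → rank w y ≡ j → i < j → x < y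
rank-cancel w x y refl refl i<j = ≰⇒> (λ y≤x → <⇒≱ i<j (s≤s (count<-mono w y≤x)))

Rank⇒rank : ∀ w x {k} → Rank x w k → rank w x ≡ suc k
Rank⇒rank w x R = cong suc (Rank⇒count< R)

module _ (a b c d : ℕ) where

  private
    w : List ℕ
    w = a ∷ b ∷ c ∷ d ∷ []

  red-1234 : red w ≡ 1 ∷ 2 ∷ 3 ∷ 4 ∷ [] ⇔ (a < b × Ascent (suc b) c d)
  red-1234 = mk⇔ ⇒ ⇐
    where
    ⇒ : map (rank w) w ≡ 1 ∷ 2 ∷ 3 ∷ 4 ∷ [] → a < b × Ascent (suc b) c d
    ⇒ eq = let e₁ , e₂ , e₃ , e₄ = map⁴⁻ (rank w) a b c d eq in
      rank-cancel w a b e₁ e₂ ≤-refl , rank-cancel w b c e₂ e₃ ≤-refl , rank-cancel w c d e₃ e₄ ≤-refl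
    ⇐ : a < b × Ascent (suc b) c d → map (rank w) w ≡ 1 ∷ 2 ∷ 3 ∷ 4 ∷ []
    ⇐ (a<b , b<c , c<d) = map⁴⁺ (rank w) a b c d
      (Rank⇒rank w a (miss ≤-refl (miss (<⇒≤ a<b) (miss (<⇒≤ a<c) (miss (<⇒≤ a<d) none)))))
      (Rank⇒rank w b (hit a<b (miss ≤-refl (miss (<⇒≤ b<c) (miss (<⇒≤ b<d) none)))))
      (Rank⇒rank w c (hit a<c (hit b<c (miss ≤-refl (miss (<⇒≤ c<d) none)))))
      (Rank⇒rank w d (hit a<d (hit b<d (hit c<d (miss ≤-refl none)))))
      where
      a<c = <-trans a<b b<c
      b<d = <-trans b<c c<d
      a<d = <-trans a<c c<d

  red-1243 : red w ≡ 1 ∷ 2 ∷ 4 ∷ 3 ∷ [] ⇔ (a < b × Descent (suc b) c d)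
  red-1243 = mk⇔ ⇒ ⇐
    where
    ⇒ : map (rank w) w ≡ 1 ∷ 2 ∷ 4 ∷ 3 ∷ [] → a < b × Descent (suc b) c d
    ⇒ eq = let e₁ , e₂ , e₃ , e₄ = map⁴⁻ (rank w) a b c d eq in
      rank-cancel w a b e₁ e₂ ≤-refl , rank-cancel w b d e₂ e₄ ≤-refl , rank-cancel w d c e₄ e₃ ≤-refl
    ⇐ : a < b × Descent (suc b) c d → map (rank w) w ≡ 1 ∷ 2 ∷ 4 ∷ 3 ∷ []
    ⇐ (a<b , b<d , d<c) = map⁴⁺ (rank w) a b c d
      (Rank⇒rank w a (miss ≤-refl (miss (<⇒≤ a<b) (miss (<⇒≤ a<c) (miss (<⇒≤ a<d) none)))))
      (Rank⇒rank w b (hit a<b (miss ≤-refl (miss (<⇒≤ b<c) (miss (<⇒≤ b<d) none)))))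
      (Rank⇒rank w c (hit a<c (hit b<c (miss ≤-refl (hit d<c none)))))
      (Rank⇒rank w d (hit a<d (hit b<d (miss (<⇒≤ d<c) (miss ≤-refl none)))))
      where
      b<c = <-trans b<d d<c
      a<d = <-trans a<b b<d
      a<c = <-trans a<b b<c

-- Pattern matches of decoded permutations.

decode : Code n → Vec (Fin n) n
decode r = V.tabulate (entry r)

letters-decode : ∀ (r : Code n) is → letters (decode r) is ≡ map (suc ∘ val r) is
letters-decode r is = map-cong (λ i → cong (suc ∘ toℕ) (lookup∘tabulate (entry r) i)) is

module _ {p q u v : ℕ} (R : ℕ → ℕ → ℕ → Set)
         (R-suc : ∀ {y i j} → R (suc y) (suc i) (suc j) ⇔ R y i j)
         (red⇔ : ∀ a b c d → red (a ∷ b ∷ c ∷ d ∷ []) ≡ p ∷ q ∷ u ∷ v ∷ [] ⇔ (a < b × R (suc b) c d)) where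

  private τ = mp (p ∷ q ∷ u ∷ v ∷ []) 2

  -- Witnesses are increasing quadruples of positions with ℓ in second place. Letters are values
  -- plus one, a shift that `R-suc` removes.
  hasMatchAt⇔ : ∀ (r : Code n) ℓ → HasMatchAt τ (decode r) ℓ ⇔ Match R n r ℓ
  hasMatchAt⇔ {n} r ℓ = mk⇔ ⇒ ⇐
    where
    s = suc ∘ val r
    ⇒ : HasMatchAt τ (decode r) ℓ → Match R n r ℓ
    ⇒ h with find h
    ... | a ∷ b ∷ i ∷ j ∷ [] , is∈ , refl , refl , red≡
      with (a<ℓ ∷ _) ∷ (ℓ<i ∷ _) ∷ (i<j ∷ _) ∷ _ ← subseqs-AllPairs (AllPairs.tabulate⁺-< id) is∈ =
      let lt , pat = to (red⇔ (s a) (s ℓ) (s i) (s j)) (trans (cong red (sym (letters-decode r _))) red≡) in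
      inj₂ (a , a<ℓ , s≤s⁻¹ lt) , i , j , ℓ<i , i<j , to R-suc pat
    ⇐ : Match R n r ℓ → HasMatchAt τ (decode r) ℓ
    ⇐ (inj₁ n≤v , _) = contradiction n≤v (<⇒≱ (toℕ<n (entry r ℓ)))
    ⇐ (inj₂ (a , a<ℓ , va<vℓ) , i , j , ℓ<i , i<j , pat) = lose
      (increasing∈subseqs
        ((a<ℓ ∷ a<i ∷ <-trans a<i i<j ∷ []) ∷ (ℓ<i ∷ <-trans ℓ<i i<j ∷ []) ∷ (i<j ∷ []) ∷ [] ∷ []))
      (refl , refl , trans (cong red (letters-decode r _))
        (from (red⇔ (s a) (s ℓ) (s i) (s j)) (s≤s va<vℓ , from R-suc pat)))
      where a<i = <-trans a<ℓ ℓ<i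

ascent-suc : ∀ {y i j} → Ascent (suc y) (suc i) (suc j) ⇔ Ascent y i j
ascent-suc = mk⇔ (λ { (s≤s p , s≤s q) → p , q }) (λ { (p , q) → s≤s p , s≤s q })

pmp-τ₁ : (r : Code n) → pmp τ₁ (decode r) ≡ matches₁ n r
pmp-τ₁ r = length-filter≡matches ascent-liftable grow₁ top₁-spec (hasMatchAt? τ₁ (decode r)) _ r id
  (hasMatchAt⇔ Ascent ascent-suc red-1234 r)

pmp-τ₂ : (r : Code n) → pmp τ₂ (decode r) ≡ matches₂ n r
pmp-τ₂ r = length-filter≡matches descent-liftable grow₂ top₂-spec (hasMatchAt? τ₂ (decode r)) _ r id
  -- `Descent` is `Ascent` with the last two arguments exchanged, so the same shift lemma fits.
  (hasMatchAt⇔ Descent ascent-suc red-1243 r)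

-- Codes correspond bijectively to permutations.

entry-injective : ∀ (r : Code n) {i j} → entry r i ≡ entry r j → i ≡ j
entry-injective (x ∷ r) {zero}  {zero}  eq = refl
entry-injective (x ∷ r) {zero}  {suc j} eq = contradiction (sym eq) (punchInᵢ≢i x (entry r j))
entry-injective (x ∷ r) {suc i} {zero}  eq = contradiction eq (punchInᵢ≢i x (entry r i))
entry-injective (x ∷ r) {suc i} {suc j} eq = cong suc (entry-injective r (punchIn-injective x _ _ eq))

entry-determines : ∀ (r s : Code n) → (∀ i → entry r i ≡ entry s i) → r ≡ s
entry-determines [] [] _ = refl
entry-determines (x ∷ r) (y ∷ s) eq with refl ← eq zero =
  cong (x ∷_) (entry-determines r s (λ i → punchIn-injective x _ _ (eq (suc i))))

decode-injective : ∀ {r s : Code n} → decode r ≡ decode s → r ≡ s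
decode-injective {r = r} {s} eq = entry-determines r s λ i → begin
  entry r i              ≡⟨ lookup∘tabulate (entry r) i ⟨
  V.lookup (decode r) i  ≡⟨ cong (λ σ → V.lookup σ i) eq ⟩
  V.lookup (decode s) i  ≡⟨ lookup∘tabulate (entry s) i ⟩
  entry s i              ∎
  where open ≡-Reasoning

-- By injectivity the later values avoid the first one, so `punchOut` can close the gap it leaves.
encode : (f : Fin n → Fin n) → (∀ {i j} → f i ≡ f j → i ≡ j) → ∃ λ r → ∀ i → entry r i ≡ f i
encode {zero} f inj = [] , λ ()
encode {suc n} f inj =
  let r , eq = encode (λ i → punchOut (f0≢ i)) (FP.suc-injective ∘ inj ∘ punchOut-injective (f0≢ _) (f0≢ _)) in
  f zero ∷ r , λ { zero → refl ; (suc i) → trans (cong (punchIn (f zero)) (eq i)) (punchIn-punchOut (f0≢ i)) }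
  where
  f0≢ : ∀ i → f zero ≢ f (suc i)
  f0≢ i eq with () ← inj eq

toList-tabulate : ∀ (f : Fin n → A) → toList (V.tabulate f) ≡ L.tabulate f
toList-tabulate {zero}  f = refl
toList-tabulate {suc n} f = cong (f zero ∷_) (toList-tabulate (f ∘ suc))

unique⇒lookup-injective : ∀ (v : Vec A n) → Unique (toList v) → ∀ {i j} → V.lookup v i ≡ V.lookup v j → i ≡ j
unique⇒lookup-injective (x V.∷ v) (x∉ ∷ u) {zero}  {zero}  eq = refl
unique⇒lookup-injective (x V.∷ v) (x∉ ∷ u) {zero}  {suc j} eq = contradiction eq (All.lookup x∉ (∈-toList⁺ (∈-lookup j v)))
unique⇒lookup-injective (x V.∷ v) (x∉ ∷ u) {suc i} {zero}  eq = contradiction (sym eq) (All.lookup x∉ (∈-toList⁺ (∈-lookup i v)))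
unique⇒lookup-injective (x V.∷ v) (x∉ ∷ u) {suc i} {suc j} eq = cong suc (unique⇒lookup-injective v u eq)

decode-isPerm : (r : Code n) → IsPerm (decode r)
decode-isPerm r = subst Unique (sym (toList-tabulate (entry r))) (Unique.tabulate⁺ (entry-injective r))

decode-surjective : (σ : Vec (Fin n) n) → IsPerm σ → ∃ λ r → decode r ≡ σ
decode-surjective σ u =
  let r , eq = encode (V.lookup σ) (unique⇒lookup-injective σ u) in
  r , trans (tabulate-cong eq) (tabulate∘lookup σ)

-- Enumerating permutations by codes.

concatMap-map≡cartesianProductWith : ∀ {C : Set} (f : A → B → C) xs ys →
  L.concatMap (λ x → map (f x) ys) xs ≡ cartesianProductWith f xs ys
concatMap-map≡cartesianProductWith f []       ys = refl
concatMap-map≡cartesianProductWith f (x ∷ xs) ys =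
  cong (map (f x) ys L.++_) (concatMap-map≡cartesianProductWith f xs ys)

allVecs-suc : ∀ n m → allVecs n (suc m) ≡ cartesianProductWith V._∷_ (allFin n) (allVecs n m)
allVecs-suc n m = concatMap-map≡cartesianProductWith V._∷_ (allFin n) (allVecs n m)

allVecs-unique : ∀ n m → Unique (allVecs n m)
allVecs-unique n zero    = [] ∷ []
allVecs-unique n (suc m) = subst Unique (sym (allVecs-suc n m))
  (Unique.cartesianProductWith⁺ V._∷_ VP.∷-injective (Unique.allFin⁺ n) (allVecs-unique n m))

∈-allVecs : ∀ {n m} (v : Vec (Fin n) m) → v ∈ allVecs n m
∈-allVecs V.[] = here refl
∈-allVecs {n} {suc m} (x V.∷ v) = subst (_ ∈_) (sym (allVecs-suc n m))
  (∈-cartesianProductWith⁺ V._∷_ (∈-allFin x) (∈-allVecs v))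

codes : ∀ n → List (Code n)
codes zero    = [] ∷ []
codes (suc n) = cartesianProductWith _∷_ (allFin (suc n)) (codes n)

codes-unique : ∀ n → Unique (codes n)
codes-unique zero    = [] ∷ []
codes-unique (suc n) =
  Unique.cartesianProductWith⁺ _∷_ ∷-injective (Unique.allFin⁺ (suc n)) (codes-unique n)

∈-codes : (r : Code n) → r ∈ codes n
∈-codes []      = here refl
∈-codes (x ∷ r) = ∈-cartesianProductWith⁺ _∷_ (∈-allFin x) (∈-codes r)

-- Two lists without repetitions that have the same members are rearrangements of each other.
Sn↭ : (f : Code n → Vec (Fin n) n) → (∀ {r s} → f r ≡ f s → r ≡ s) → (∀ r → IsPerm (f r)) →
      (∀ σ → IsPerm σ → ∃ λ r → f r ≡ σ) → Sn n ↭ map f (codes n)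
Sn↭ {n} f inj perm surj = ∼bag⇒↭ (unique∧set⇒bag
  (Unique.filter⁺ isPerm? (allVecs-unique n n)) (Unique.map⁺ inj (codes-unique n)) (mk⇔ ⇒ ⇐))
  where
  ⇒ : ∀ {σ} → σ ∈ Sn n → σ ∈ map f (codes n)
  ⇒ σ∈ with r , refl ← surj _ (proj₂ (∈-filter⁻ isPerm? {xs = allVecs n n} σ∈)) = ∈-map⁺ f (∈-codes r)
  ⇐ : ∀ {σ} → σ ∈ map f (codes n) → σ ∈ Sn n
  ⇐ σ∈ with r , _ , refl ← ∈-map⁻ f σ∈ = ∈-filter⁺ isPerm? (∈-allVecs _) (perm r)

length-filter-map : ∀ {P : A → Set} {Q : B → Set} (P? : Decidable P) (Q? : Decidable Q) (f : A → B)
  xs → (∀ x → P x ⇔ Q (f x)) → length (filter P? xs) ≡ length (filter Q? (map f xs))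
length-filter-map P? Q? f [] P⇔Q = refl
length-filter-map P? Q? f (x ∷ xs) P⇔Q with P? x
... | yes p = trans (cong suc (length-filter-map P? Q? f xs P⇔Q)) (cong length (sym (filter-accept Q? (to (P⇔Q x) p))))
... | no ¬p = trans (length-filter-map P? Q? f xs P⇔Q) (cong length (sym (filter-reject Q? (¬p ∘ from (P⇔Q x)))))

coeff≡ : ∀ n τ k {m : Code n → ℕ} (f : Code n → Vec (Fin n) n) → Sn n ↭ map f (codes n) →
  (∀ r → m r ≡ pmp τ (f r)) → coeff τ n k ≡ length (filter (λ r → m r ≟ k) (codes n))
coeff≡ n τ k {m} f Sn↭ m≡ = trans (↭-length (filter-↭ (λ σ → pmp τ σ ≟ k) Sn↭))
  (sym (length-filter-map (λ r → m r ≟ k) (λ σ → pmp τ σ ≟ k) f (codes n)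
    (λ r → mk⇔ (trans (sym (m≡ r))) (trans (m≡ r)))))

theorem7 : (n : ℕ) → n ≥ 1 → (k : ℕ) → coeff τ₁ n k ≡ coeff τ₂ n k
theorem7 n _ k = trans
  (coeff≡ n τ₁ k decode (Sn↭ decode decode-injective decode-isPerm decode-surjective) (λ r → sym (pmp-τ₁ r)))
  -- Listing the permutations through `decode ∘ transfer n` turns the statistic of `τ₂` into
  -- `matches₁ n`, so both coefficients count the same codes.
  (sym (coeff≡ n τ₂ k (decode ∘ transfer n)
    (Sn↭ (decode ∘ transfer n) (transfer-injective n _ _ ∘ decode-injective) (decode-isPerm ∘ transfer n) surj)
    (λ r → trans (proj₁ (transfer-stats n r)) (sym (pmp-τ₂ (transfer n r))))))
  where
  surj : ∀ σ → IsPerm σ → ∃ λ r → decode (transfer n r) ≡ σ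
  surj σ u with s , refl ← decode-surjective σ u with r , refl ← transfer-surjective n s = r , refl
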